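{- Let $G=(V,E)$ be a locally path-bounded digraph. Then $G$ has a unique $\gamma$-function with an associated counter function; that is, there is exactly one function $\gamma\colon V\to\mathbb{Z}^0\cup\{\infty\}$ for which there exist an infinite well-ordered set $J$ and a function $c\colon V^f\to J$ (where $V^f=\{u\in V:\gamma(u)<\infty\}$) such that $\gamma$ is a $\gamma$-function on $G$ with counter function $c$. Moreover, for every $u\in V^f$, $\gamma(u)$ does not exceed the length of a longest path in $G$ emanating from $u$.
   Context: $\mathbb{Z}^0$ denotes the set of nonnegative integers. Digraphs $G=(V,E)$, $E\subseteq V\times V$, may be finite or infinite and may contain cycles and loops. For $u\in V$, the set of followers of $u$ is $F(u)=\{v\in V:(u,v)\in E\}$ (possibly infinite or empty). A walk is a sequence of vertices $u_1,u_2,\ldots$ with $u_{i+1}\in F(u_i)$ for all $i$; a path is a walk all of whose vertices are distinct; the length of a path is the number of its edges. A path emanates from $u$ if its first vertex is $u$. Locally path-bounded: $G$ is locally path-bounded if for every vertex $u\in V$ there is a bound $b(u)\in\mathbb{Z}^0$ (depending on $u$) such that every directed path emanating from $u$ has length at most $b(u)$. mex: for $S\subsetneq\mathbb{Z}^0$, $\operatorname{mex} S=\min(\mathbb{Z}^0\setminus S)$. Notation for a function $\gamma\colon V\to\mathbb{Z}^0\cup\{\infty\}$, where $\infty$ is a symbol regarded as larger than every natural number: $V^f=\{u\in V:\gamma(u)<\infty\}$; for $u\in V$, $\gamma(F(u))=\{\gamma(v):v\in F(u),\ \gamma(v)<\infty\}$ (only finite values are collected); $\gamma'(u)=\operatorname{mex}\gamma(F(u))$.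 If $\gamma(u)=\infty$ and $\gamma(F(u))=K$, one also writes $\gamma(u)=\infty(K)$. Definition ($\gamma$-function, also called the generalized Sprague-Grundy function): $\gamma\colon V\to\mathbb{Z}^0\cup\{\infty\}$ is a $\gamma$-function with counter function $c\colon V^f\to J$, where $J$ is any infinite well-ordered set, if the following three conditions hold (whenever a condition refers to $\gamma'(u)$, it includes the requirement that this mex exists). A. If $\gamma(u)<\infty$, then $\gamma(u)=\gamma'(u)$. B. If there exists $v\in F(u)$ with $\gamma(v)>\gamma(u)$ (so $\gamma(u)<\infty$, and $\gamma(v)=\infty$ is allowed), then there exists $w\in F(v)$ satisfying $\gamma(w)=\gamma(u)$ and $c(w)<c(u)$. (This is required for every such $v$.) C. If $\gamma(u)=\infty$, then there is $v\in F(u)$ with $\gamma(v)=\infty(K)$ (i.e. $\gamma(v)=\infty$ and $K=\gamma(F(v))$) such that $\gamma'(u)\notin K$. The counter function is not required to be unique. -}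

module Defs where

open import Data.Fin.Base using (Fin; zero; suc; inject₁)
open import Data.Nat.Base using (ℕ; suc; _≤_; _<_)
open import Data.Product.Base using (Σ-syntax; ∃; ∃-syntax; _×_; proj₁)
open import Function.Bundles using (_⤖_)
open import Function.Definitions using (Injective)
open import Induction.WellFounded using (WellFounded)
open import Level using (Level; _⊔_) renaming (suc to lsuc)
open import Relation.Binary.Core using (Rel)
open import Relation.Binary.PropositionalEquality.Core using (_≡_)
open import Relation.Binary.Structures using (IsStrictTotalOrder)
open import Relation.Nullary.Construct.Add.Supremum using (_⁺; ⊤⁺; [_])
open import Relation.Nullary.Negation.Core using (¬_)
open import Relation.Unary using (Pred; ∁; _∈_; _∉_)

import Relation.Binary.Construct.Add.Supremum.Strict as AddSupremum

open AddSupremum (_<_) public using (_<⁺_)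

private
  variable
    v e ℓ : Level

ℕ∞ : Set
ℕ∞ = ℕ ⁺

∞ : ℕ∞
∞ = ⊤⁺

-- A relation rather than an operation: it can hold for some m only when S
-- is a proper subset of ℕ, so "S has mex m" includes "the mex of S exists".
IsMex : Pred ℕ ℓ → ℕ → Set ℓ
IsMex S m = m ∈ ∁ S × (∀ {n} → n ∈ ∁ S → m ≤ n)

record InfiniteWellOrder (j r : Level) : Set (lsuc (j ⊔ r)) where
  infix 4 _≺_
  field
    Carrier            : Set j
    _≺_                : Rel Carrier r
    isStrictTotalOrder : IsStrictTotalOrder _≡_ _≺_
    wellFounded        : WellFounded _≺_
    infinite           : ¬ (∃[ n ] (Fin n ⤖ Carrier))

record Digraph (v e : Level) : Set (lsuc (v ⊔ e)) where
  field
    V : Set v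
    E : Rel V e

  F : V → Pred V e
  F u w = E u w

  -- Finite paths suffice for path-boundedness: the initial segments of an
  -- infinite path are finite paths of every length.
  record Path (u : V) (length : ℕ) : Set (v ⊔ e) where
    field
      vertex   : Fin (suc length) → V
      start    : vertex zero ≡ u
      edge     : ∀ i → vertex (suc i) ∈ F (vertex (inject₁ i))
      distinct : Injective _≡_ _≡_ vertex

  LocallyPathBounded : Set (v ⊔ e)
  LocallyPathBounded = ∀ u → ∃[ b ] (∀ {n} → Path u n → n ≤ b)

  IsLongestPathLength : V → ℕ → Set (v ⊔ e)
  IsLongestPathLength u l = Path u l × (∀ {n} → Path u n → n ≤ l)

  module _ (γ : V → ℕ∞) where

    Vᶠ : Set v
    Vᶠ = ∃[ u ] γ u <⁺ ∞

    γ⟨F_⟩ : V → Pred ℕ (v ⊔ e)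
    γ⟨F u ⟩ n = ∃[ w ] (w ∈ F u × γ w ≡ [ n ])

    -- γ′ u ≔ m reads "γ′(u) exists and equals m".
    γ′_≔_ : V → ℕ → Set (v ⊔ e)
    γ′ u ≔ m = IsMex γ⟨F u ⟩ m

    -- In condB the vertex u ranges over Vᶠ only, since γ u <⁺ γ x already
    -- forces γ u <⁺ ∞.
    record IsGammaFunction {j r} (J : InfiniteWellOrder j r)
                           (c : Vᶠ → InfiniteWellOrder.Carrier J)
                           : Set (v ⊔ e ⊔ r) where
      open InfiniteWellOrder J using (_≺_)
      field
        condA : ∀ u → γ u <⁺ ∞ → ∃[ m ] ((γ′ u ≔ m) × γ u ≡ [ m ])
        condB : ∀ (u : Vᶠ) x → x ∈ F (proj₁ u) → γ (proj₁ u) <⁺ γ x →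
                Σ[ w ∈ Vᶠ ] (proj₁ w ∈ F x × γ (proj₁ w) ≡ γ (proj₁ u) × c w ≺ c u)
        condC : ∀ u → γ u ≡ ∞ →
                ∃[ x ] (x ∈ F u × γ x ≡ ∞ × ∃[ m ] ((γ′ u ≔ m) × m ∉ γ⟨F x ⟩))

  HasCounter : (j r : Level) → (V → ℕ∞) → Set (v ⊔ e ⊔ lsuc (j ⊔ r))
  HasCounter j r γ =
    Σ[ J ∈ InfiniteWellOrder j r ]
      Σ[ c ∈ (Vᶠ γ → InfiniteWellOrder.Carrier J) ] IsGammaFunction γ J c

{-# OPTIONS --safe #-}

-- Existence.  Values are assigned in increasing order.  A vertex u without a
-- value below m receives m when every l < m occurs among its followers and
-- every follower without a value below m can be answered by a vertex that
-- received m at an earlier stage; the counter is the stage.  Stages indexed by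
-- ℕ suffice: a follower of u that can first be answered at stage n starts
-- an alternating walk whose vertices are distinct because the stages decrease,
-- and which avoids u if u receives no value, so n ≤ b(u).
--
-- Uniqueness.  Suppose every γ₁-value below m is also the γ₂-value and
-- γ₁(u) = m ≠ γ₂(u).  Then some follower of u has no follower of γ₂-value m,
-- and condition B for γ₁ answers it with another such u, of smaller counter.
module Submission where

open import Defs
open import Axiom.ExcludedMiddle using (ExcludedMiddle)
open import Data.Empty.Polymorphic using (⊥)
open import Data.Fin.Base using (Fin; zero; suc; inject₁)
open import Data.Fin.Properties using (ℕ→Fin-notInjective)
open import Data.Nat.Base using (ℕ; zero; suc; _≤_; _<_; z≤n; s≤s; s≤s⁻¹)
open import Data.Nat.Induction using (<-rec; <-wellFounded)
open import Data.Nat.Properties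
open import Data.Product using (∃!; Σ-syntax; ∃; ∃-syntax; _×_; _,_; proj₁; proj₂; map₂)
open import Data.Sum.Base using (_⊎_; inj₁; inj₂)
open import Data.Unit.Polymorphic using (⊤; tt)
open import Function.Base using (_∘_)
open import Function.Bundles using (Bijection)
open import Induction.WellFounded using (Acc; acc)
open import Level using (Level; _⊔_; Lift; lift; lower)
open import Relation.Binary.Core using (Rel)
open import Relation.Binary.Definitions using (Trichotomous; tri<; tri≈; tri>)
open import Relation.Binary.PropositionalEquality
  using (_≡_; _≢_; _≗_; refl; sym; trans; cong; subst; subst₂; isEquivalence)
open import Relation.Nullary using (yes; no; ¬_; contradiction; decidable-stable)
open import Relation.Nullary.Construct.Add.Supremum using ([_]; ⊤⁺; []-injective)
open import Relation.Unary using (Pred; _∈_; _∉_)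

import Relation.Binary.Construct.Add.Supremum.Strict as AddSupremum
open AddSupremum (_<_) using ([_]; [_]<⊤⁺; [<]-injective)

private
  variable
    ℓ : Level

-- Least elements, values in ℕ∞ and a well-order for counters.

IsLeast : Pred ℕ ℓ → Pred ℕ ℓ
IsLeast P n = P n × (∀ {k} → P k → n ≤ k)

IsLeast-unique : {P : Pred ℕ ℓ} {a b : ℕ} → IsLeast P a → IsLeast P b → a ≡ b
IsLeast-unique (Pa , a≤) (Pb , b≤) = ≤-antisym (a≤ Pb) (b≤ Pa)

<⁺∞⇒finite : ∀ {x} → x <⁺ ∞ → ∃[ m ] x ≡ [ m ]
<⁺∞⇒finite [ m ]<⊤⁺ = m , refl

exceeds⇒<⁺ : ∀ {m} x → (∀ {k} → k ≤ m → x ≢ [ k ]) → [ m ] <⁺ x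
exceeds⇒<⁺ {m} [ k ] h with m <? k
... | yes m<k = [ m<k ]
... | no  m≮k = contradiction refl (h (≮⇒≥ m≮k))
exceeds⇒<⁺ {m} ⊤⁺ h = [ m ]<⊤⁺

-- The lifts place ℕ and its order at whatever levels `HasCounter` asks for.
ℕ-infiniteWellOrder : ∀ j r → InfiniteWellOrder j r
ℕ-infiniteWellOrder j r = record
  { Carrier            = Lift j ℕ
  ; _≺_                = _≺_
  ; isStrictTotalOrder = record
    { isStrictPartialOrder = record
      { isEquivalence = isEquivalence
      ; irrefl        = λ { refl (lift p) → <-irrefl refl p }
      ; trans         = λ { (lift p) (lift q) → lift (<-trans p q) }
      ; <-resp-≈      = (λ { refl p → p }) , (λ { refl p → p })
      }
    ; compare = compare
    }
  ; wellFounded        = λ x → accessible (<-wellFounded (lower x))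
  ; infinite           = λ (n , bij) →
      let open Bijection bij using (to; surjective) in
      ℕ→Fin-notInjective (λ k → proj₁ (surjective (lift k)))
        (λ {a} {b} eq → cong lower
          (trans (sym (proj₂ (surjective (lift a)) refl))
            (trans (cong to eq)
              (proj₂ (surjective (lift b)) refl))))
  }
  where
  _≺_ : Rel (Lift j ℕ) r
  a ≺ b = Lift r (lower a < lower b)

  compare : Trichotomous _≡_ _≺_
  compare (lift a) (lift b) with <-cmp a b
  ... | tri< p ¬q ¬r = tri< (lift p) (¬q ∘ cong lower) (¬r ∘ lower)
  ... | tri≈ ¬p q ¬r = tri≈ (¬p ∘ lower) (cong lift q) (¬r ∘ lower)
  ... | tri> ¬p ¬q r = tri> (¬p ∘ lower) (¬q ∘ cong lower) (lift r)

  accessible : ∀ {x} → Acc _<_ (lower x) → Acc _≺_ x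
  accessible (acc rs) = acc λ (lift y<x) → accessible (rs y<x)

module _ (em : ∀ {ℓ} → ExcludedMiddle ℓ) where

  dne : {P : Set ℓ} → ¬ ¬ P → P
  dne = decidable-stable em

  least : {P : Pred ℕ ℓ} → ∃ P → ∃ (IsLeast P)
  least {P = P} (n , Pn) = <-rec (λ n → P n → ∃ (IsLeast P)) step n Pn
    where
    step : ∀ n → (∀ {k} → k < n → P k → ∃ (IsLeast P)) → P n → ∃ (IsLeast P)
    step n rec Pn with em {P = ∃[ k ] (k < n × P k)}
    ... | yes (k , k<n , Pk) = rec k<n Pk
    ... | no  none           = n , Pn , λ Pk → ≮⇒≥ (λ k<n → none (_ , k<n , Pk))

  below-mex : {S : Pred ℕ ℓ} {m k : ℕ} → IsMex S m → k < m → k ∈ S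
  below-mex (_ , m≤) k<m = dne λ k∉S → <⇒≱ k<m (m≤ k∉S)

  module _ {v e} (G : Digraph v e) where
    open Digraph G

    -- Paths and their lengths.

    trivialPath : ∀ u → Path u 0
    trivialPath u = record
      { vertex   = λ _ → u
      ; start    = refl
      ; edge     = λ ()
      ; distinct = λ { {zero} {zero} _ → refl }
      }

    consPath : ∀ {u w n} → w ∈ F u → (p : Path w n) →
               (∀ i → Path.vertex p i ≢ u) → Path u (suc n)
    consPath {u} {w} {n} w∈Fu p avoids = record
      { vertex   = vertex′
      ; start    = refl
      ; edge     = edge′
      ; distinct = distinct′
      }
      where
      open Path p
      vertex′ : Fin (suc (suc n)) → V
      vertex′ zero    = u
      vertex′ (suc i) = vertex i

      edge′ : ∀ i → vertex′ (suc i) ∈ F (vertex′ (inject₁ i))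
      edge′ zero    = subst (E u) (sym start) w∈Fu
      edge′ (suc i) = edge i

      distinct′ : ∀ {i j} → vertex′ i ≡ vertex′ j → i ≡ j
      distinct′ {zero}  {zero}  _  = refl
      distinct′ {zero}  {suc j} eq = contradiction (sym eq) (avoids j)
      distinct′ {suc i} {zero}  eq = contradiction eq (avoids i)
      distinct′ {suc i} {suc j} eq = cong suc (distinct eq)

    module _ (Rank : ℕ → Pred V ℓ)
             (functional : ∀ {a b x} → Rank a x → Rank b x → a ≡ b)
             (step : ∀ {k x} → Rank (suc k) x → ∃[ y ] (y ∈ F x × Rank k y)) where

      -- Ranks drop by one at each step and a vertex has only one rank, so no vertex repeats. The
      -- ranks of the visited vertices are returned as well: they carry the induction, and they let
      -- callers show that an unranked vertex is avoided.
      rankedPath : ∀ k {x} → Rank k x →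
                   Σ[ p ∈ Path x k ] (∀ i → ∃[ j ] (j ≤ k × Rank j (Path.vertex p i)))
      rankedPath zero    {x} r = trivialPath x , λ _ → 0 , z≤n , r
      rankedPath (suc k) {x} r
        with y , y∈Fx , ry ← step r
        with p , ranks ← rankedPath k ry =
        consPath y∈Fx p avoids , λ where
          zero    → suc k , ≤-refl , r
          (suc i) → map₂ (λ (j≤k , rj) → m≤n⇒m≤1+n j≤k , rj) (ranks i)
        where
        avoids : ∀ i → Path.vertex p i ≢ x
        avoids i eq with j , j≤k , rj ← ranks i =
          <-irrefl (functional (subst (Rank j) eq rj) r) (s≤s j≤k)

    -- The least bound is attained: if no path had length `suc l`, then `l` would be a smaller
    -- bound.
    longestPath : LocallyPathBounded → ∀ u → ∃ (IsLongestPathLength u)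
    longestPath bounded u with least (bounded u)
    ... | zero  , ub , _ = zero , trivialPath u , ub
    ... | suc l , ub , minimal with em {P = Path u (suc l)}
    ...   | yes p = suc l , p , ub
    ...   | no ¬p = contradiction (minimal ub′) 1+n≰n
      where
      ub′ : ∀ {n} → Path u n → n ≤ l
      ub′ p = s≤s⁻¹ (≤∧≢⇒< (ub p) λ { refl → ¬p p })

    module _ {j r} {γ : V → ℕ∞} (h : HasCounter j r γ) where
      open IsGammaFunction (proj₂ (proj₂ h))

      finite⇒mex : ∀ {u m} → γ u ≡ [ m ] → γ′_≔_ γ u m
      finite⇒mex {u} {m} eq with condA u (subst (_<⁺ ∞) (sym eq) [ m ]<⊤⁺)
      ... | k , mex , eq′ = subst (γ′_≔_ γ u) ([]-injective (trans (sym eq′) eq)) mex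

      -- By condition A a vertex of value `suc k` has a follower of value `k`, so the values
      -- themselves serve as ranks.
      γ-path : ∀ {u k} → γ u ≡ [ k ] → Path u k
      γ-path {u} {k} eq = proj₁ (rankedPath (λ k x → γ x ≡ [ k ])
        (λ eq₁ eq₂ → []-injective (trans (sym eq₁) eq₂))
        (λ eq → below-mex (finite⇒mex eq) ≤-refl)
        k eq)

    -- Uniqueness.

    module _ {j₁ r₁ j₂ r₂} {γ₁ γ₂ : V → ℕ∞}
             (h₁ : HasCounter j₁ r₁ γ₁)
             (h₂ : HasCounter j₂ r₂ γ₂) where
      private
        module γ₁ = IsGammaFunction (proj₂ (proj₂ h₁))
        module γ₂ = IsGammaFunction (proj₂ (proj₂ h₂))
        c = proj₁ (proj₂ h₁)
      open InfiniteWellOrder (proj₁ h₁) using (_≺_; wellFounded)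

      -- The descent along counters becomes well-founded induction on the `γ₁`-counter: `go` may
      -- assume the claim for vertices of `γ₁`-value `m` with a smaller counter.
      agree-step : ∀ m →
        (∀ {k} → k < m → ∀ {x} → γ₁ x ≡ [ k ] → γ₂ x ≡ [ k ]) →
        ∀ {u} → γ₁ u ≡ [ m ] → γ₂ u ≡ [ m ]
      agree-step m below₁₂ {u₀} eq₀ =
        go (u₀ , subst (_<⁺ ∞) (sym eq₀) [ m ]<⊤⁺) (wellFounded _) eq₀
        where
        go : ∀ (u : Vᶠ γ₁) → Acc _≺_ (c u) → γ₁ (proj₁ u) ≡ [ m ] → γ₂ (proj₁ u) ≡ [ m ]
        go uᶠ@(u , _) (acc rs) eq₁ = value (γ₂ u) refl
          where
          mex₁ : γ′_≔_ γ₁ u m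
          mex₁ = finite⇒mex h₁ eq₁

          large₁ : ∀ {x} → x ∈ F u → (∀ {k} → k < m → γ₂ x ≢ [ k ]) →
                   ∀ {k} → k ≤ m → γ₁ x ≢ [ k ]
          large₁ {x} x∈Fu large k≤m eq with m≤n⇒m<n∨m≡n k≤m
          ... | inj₁ k<m  = large k<m (below₁₂ k<m eq)
          ... | inj₂ refl = proj₁ mex₁ (x , x∈Fu , eq)

          -- Values below `m` transfer to `γ₂` and the mex at `u` excludes `m`, so `γ₁ x` exceeds
          -- `m`. Condition B then yields a follower of `x` with `γ₁`-value `m` and smaller counter;
          -- by induction its `γ₂`-value is `m` too.
          ¬unanswered : ∀ {x} → x ∈ F u → (∀ {k} → k < m → γ₂ x ≢ [ k ]) →
                        ¬ (m ∉ γ⟨F_⟩ γ₂ x)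
          ¬unanswered {x} x∈Fu large m∉
            with w , w∈Fx , γw≡γu , cw≺cu ← γ₁.condB uᶠ x x∈Fu
                   (subst (_<⁺ γ₁ x) (sym eq₁) (exceeds⇒<⁺ (γ₁ x) (large₁ x∈Fu large)))
            = m∉ (proj₁ w , w∈Fx , go w (rs cw≺cu) (trans γw≡γu eq₁))

          m∉γ₂⟨Fu⟩ : m ∉ γ⟨F_⟩ γ₂ u
          -- By its own mex, a follower of `γ₂`-value `m` has no follower of that value.
          m∉γ₂⟨Fu⟩ (x , x∈Fu , eq) = ¬unanswered x∈Fu
            (λ k<m eq′ → <-irrefl ([]-injective (trans (sym eq′) eq)) k<m)
            (proj₁ (finite⇒mex h₂ eq))

          below∈γ₂⟨Fu⟩ : ∀ {k} → k < m → k ∈ γ⟨F_⟩ γ₂ u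
          below∈γ₂⟨Fu⟩ k<m with x , x∈Fu , eq ← below-mex mex₁ k<m = x , x∈Fu , below₁₂ k<m eq

          mex₂ : γ′_≔_ γ₂ u m
          mex₂ = m∉γ₂⟨Fu⟩ , λ n∉ → ≮⇒≥ (n∉ ∘ below∈γ₂⟨Fu⟩)

          value : ∀ z → γ₂ u ≡ z → γ₂ u ≡ [ m ]
          value [ n ] eq = trans eq (cong [_] (IsLeast-unique (finite⇒mex h₂ eq) mex₂))
          -- Condition C would give an infinite follower that cannot be answered at the mex of `u`,
          -- and `mex₂` identifies this mex as `m`.
          value ⊤⁺ eq with γ₂.condC u eq
          ... | x , x∈Fu , γx≡∞ , p , mexp , p∉ with IsLeast-unique mexp mex₂
          ...   | refl = contradiction p∉
            (¬unanswered x∈Fu λ _ eq′ → contradiction (trans (sym γx≡∞) eq′) λ ())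

    γ-unique : ∀ {j₁ r₁ j₂ r₂} {γ₁ γ₂ : V → ℕ∞} →
               HasCounter j₁ r₁ γ₁ → HasCounter j₂ r₂ γ₂ → γ₁ ≗ γ₂
    γ-unique {γ₁ = γ₁} {γ₂} h₁ h₂ u = compare (γ₁ u) (γ₂ u) refl refl
      where
      Agree : ℕ → Set v
      Agree m = (∀ {x} → γ₁ x ≡ [ m ] → γ₂ x ≡ [ m ]) × (∀ {x} → γ₂ x ≡ [ m ] → γ₁ x ≡ [ m ])

      agree : ∀ m → Agree m
      agree = <-rec Agree λ m rec →
        agree-step h₁ h₂ m (λ k<m → proj₁ (rec k<m)) ,
        agree-step h₂ h₁ m (λ k<m → proj₂ (rec k<m))

      compare : ∀ a b → γ₁ u ≡ a → γ₂ u ≡ b → γ₁ u ≡ γ₂ u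
      compare [ m ] _     eq₁ _   = trans eq₁ (sym (proj₁ (agree m) eq₁))
      compare ⊤⁺    [ m ] _   eq₂ = trans (proj₂ (agree m) eq₂) (sym eq₂)
      compare ⊤⁺    ⊤⁺    eq₁ eq₂ = trans eq₁ (sym eq₂)

    -- Labels assigned in stages.

    mutual
      -- `Below` and `Full` recurse on `m` instead of quantifying over `l < m`, which keeps the
      -- mutual definition structurally recursive in `m`, then in the stage.
      Below : ℕ → Pred V (v ⊔ e)
      Below zero    u = ⊥
      Below (suc m) u = Below m u ⊎ Label m u

      Full : ℕ → Pred V (v ⊔ e)
      Full zero    u = ⊤
      Full (suc m) u = Full m u × ∃[ w ] (w ∈ F u × Label m w)

      Label : ℕ → Pred V (v ⊔ e)
      Label m u = ∃[ n ] Stage m n u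

      -- Cumulative in the stage: the label `m` is received at stage `n` or earlier. Stage 0 is
      -- empty, so at stage 1 every follower must already lie below `m`.
      Stage : ℕ → ℕ → Pred V (v ⊔ e)
      Stage m zero    u = ⊥
      Stage m (suc n) u =
        ¬ Below m u × Full m u × (∀ {x} → x ∈ F u → Below m x ⊎ Answer m n x)

      Answer : ℕ → ℕ → Pred V (v ⊔ e)
      Answer m n x = ∃[ w ] (w ∈ F x × Stage m n w)

    Label⇒¬Below : ∀ {m u} → Label m u → ¬ Below m u
    Label⇒¬Below (suc _ , ¬below , _) = ¬below

    Label⇒Full : ∀ {m u} → Label m u → Full m u
    Label⇒Full (suc _ , _ , full , _) = full

    Below⁺ : ∀ {m l u} → l < m → Label l u → Below m u
    Below⁺ {suc m} l<1+m label with m<1+n⇒m<n∨m≡n l<1+m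
    ... | inj₁ l<m  = inj₁ (Below⁺ l<m label)
    ... | inj₂ refl = inj₂ label

    Below⁻ : ∀ m {u} → Below m u → ∃[ l ] (l < m × Label l u)
    Below⁻ (suc m) (inj₁ below) with l , l<m , label ← Below⁻ m below = l , m<n⇒m<1+n l<m , label
    Below⁻ (suc m) (inj₂ label) = m , ≤-refl , label

    Full⁺ : ∀ m {u} → (∀ {l} → l < m → ∃[ w ] (w ∈ F u × Label l w)) → Full m u
    Full⁺ zero    h = tt
    Full⁺ (suc m) h = Full⁺ m (λ l<m → h (m<n⇒m<1+n l<m)) , h ≤-refl

    Full⁻ : ∀ {m l u} → Full m u → l < m → ∃[ w ] (w ∈ F u × Label l w)
    Full⁻ {suc m} (full , here) l<1+m with m<1+n⇒m<n∨m≡n l<1+m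
    ... | inj₁ l<m  = Full⁻ full l<m
    ... | inj₂ refl = here

    Label-unique : ∀ {a b u} → Label a u → Label b u → a ≡ b
    Label-unique {a} {b} la lb with <-cmp a b
    ... | tri< a<b _ _ = contradiction (Below⁺ a<b la) (Label⇒¬Below lb)
    ... | tri≈ _ eq _  = eq
    ... | tri> _ _ b<a = contradiction (Below⁺ b<a lb) (Label⇒¬Below la)

    Stage-mono : ∀ m {a b u} → a ≤ b → Stage m a u → Stage m b u
    Stage-mono m {suc a} {suc b} (s≤s a≤b) (¬below , full , answer) =
      ¬below , full , λ x∈Fu → weaken (answer x∈Fu)
      where
      weaken : ∀ {x} → Below m x ⊎ Answer m a x → Below m x ⊎ Answer m b x
      weaken (inj₁ below)          = inj₁ below
      weaken (inj₂ (w , w∈Fx , s)) = inj₂ (w , w∈Fx , Stage-mono m a≤b s)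

    Answer-mono : ∀ m {a b x} → a ≤ b → Answer m a x → Answer m b x
    Answer-mono m a≤b (w , w∈Fx , s) = w , w∈Fx , Stage-mono m a≤b s

    -- Since `x` carries label `m`, it is not below `m`, so `u` must have it answered by some `w` of
    -- an earlier stage. Then `x` and `w` form the same configuration with a smaller sum of stages.
    Stage-independent : ∀ m a b {u x} → Stage m a u → x ∈ F u → ¬ Stage m b x
    Stage-independent m (suc a) (suc b) (_ , _ , answer) x∈Fu sx with answer x∈Fu
    ... | inj₁ below            = proj₁ sx below
    ... | inj₂ (w , w∈Fx , sw) = Stage-independent m (suc b) a sx w∈Fx sw

    -- Alternating walks and closure of the labelling.

    FirstStage FirstAnswer : ℕ → ℕ → Pred V (v ⊔ e)
    FirstStage  m n x = IsLeast (λ k → Stage  m k x) n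
    FirstAnswer m n x = IsLeast (λ k → Answer m k x) n

    double : ℕ → ℕ
    double zero    = zero
    double (suc n) = suc (suc (double n))

    n≤double : ∀ n → n ≤ double n
    n≤double zero    = z≤n
    n≤double (suc n) = s≤s (m≤n⇒m≤1+n (n≤double n))

    -- Vertices with label m take the even ranks and vertices answered by them the
    -- odd ones, so that each move of the alternating walk lowers the rank by one.
    Rank : ℕ → ℕ → Pred V (v ⊔ e)
    Rank m k x = (∃[ n ] (k ≡ double n × FirstStage m (suc n) x))
               ⊎ (∃[ n ] (k ≡ suc (double n) × FirstAnswer m (suc n) x))

    -- Even and odd ranks cannot meet: a vertex with label `m` would have a follower with label `m`.
    Rank-functional : ∀ m {a b x} → Rank m a x → Rank m b x → a ≡ b
    Rank-functional m (inj₁ (_ , refl , f)) (inj₁ (_ , refl , g)) =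
      cong double (suc-injective (IsLeast-unique f g))
    Rank-functional m (inj₂ (_ , refl , f)) (inj₂ (_ , refl , g)) =
      cong (suc ∘ double) (suc-injective (IsLeast-unique f g))
    Rank-functional m (inj₁ (_ , _ , s , _)) (inj₂ (_ , _ , (_ , w∈Fx , t) , _)) =
      contradiction t (Stage-independent m _ _ s w∈Fx)
    Rank-functional m (inj₂ (_ , _ , (_ , w∈Fx , t) , _)) (inj₁ (_ , _ , s , _)) =
      contradiction t (Stage-independent m _ _ s w∈Fx)

    FirstAnswer-step : ∀ m n {x} → FirstAnswer m n x → ∃[ w ] (w ∈ F x × FirstStage m n w)
    FirstAnswer-step m n ((w , w∈Fx , s) , minimal) =
      w , w∈Fx , s , λ t → minimal (w , w∈Fx , t)

    -- As `x` is missing from stage `suc n`, some follower is neither below `m` nor answered at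
    -- stage `n`; stage `suc n` is then the first to answer it.
    FirstStage-step : ∀ m n {x} → FirstStage m (suc (suc n)) x →
                      ∃[ y ] (y ∈ F x × FirstAnswer m (suc n) y)
    FirstStage-step m n {x} ((¬below , full , answer) , minimal) = found
      where
      late : ∃[ y ] (y ∈ F x × ¬ (Below m y ⊎ Answer m n y))
      late = dne λ none → 1+n≰n
        (minimal (¬below , full , λ {y} y∈Fx → dne λ no-answer → none (y , y∈Fx , no-answer)))

      found : ∃[ y ] (y ∈ F x × FirstAnswer m (suc n) y)
      found with late
      ... | y , y∈Fx , none with answer y∈Fx
      ...   | inj₁ below = contradiction (inj₁ below) none
      ...   | inj₂ ans   = y , y∈Fx , ans ,
        λ ans′ → ≰⇒> λ k≤n → none (inj₂ (Answer-mono m k≤n ans′))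

    Rank-step : ∀ m {k x} → Rank m (suc k) x → ∃[ y ] (y ∈ F x × Rank m k y)
    Rank-step m (inj₁ (suc n , refl , first))
      with y , y∈Fx , first′ ← FirstStage-step m n first = y , y∈Fx , inj₂ (n , refl , first′)
    Rank-step m (inj₂ (n , refl , first))
      with w , w∈Fx , first′ ← FirstAnswer-step m (suc n) first = w , w∈Fx , inj₁ (n , refl , first′)

    -- Each follower is answered at some stage; path-boundedness at `u` makes one stage, `b`, serve
    -- all of them, so `u` enters at `suc b`.
    Label-closed : LocallyPathBounded → ∀ m {u} → ¬ Below m u → Full m u →
                   (∀ {w} → w ∈ F u → ¬ Label m w) →
                   (∀ {x} → x ∈ F u → Below m x ⊎ (∃[ w ] (w ∈ F x × Label m w))) →
                   Label m u
    Label-closed bounded m {u} ¬below full independent answers = dne λ unlabelled →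
      unlabelled (suc b , ¬below , full , λ {x} x∈Fu → bound unlabelled x∈Fu (answers x∈Fu))
      where
      b : ℕ
      b = proj₁ (bounded u)

      bound : ¬ Label m u → ∀ {x} → x ∈ F u →
              Below m x ⊎ (∃[ w ] (w ∈ F x × Label m w)) → Below m x ⊎ Answer m b x
      bound _ _ (inj₁ below) = inj₁ below
      bound unlabelled {x} x∈Fu (inj₂ (w , w∈Fx , k , s))
        with least {P = λ n → Answer m n x} (k , w , w∈Fx , s)
      ... | suc n , first
        with p , ranks ← rankedPath (Rank m) (Rank-functional m) (Rank-step m) _
                           (inj₂ (n , refl , first)) =
        -- The walk from `x` has length `suc (double n)`; prepending `u` gives
        -- `suc (suc (double n)) ≤ b`, hence `suc n ≤ b`.
        inj₂ (Answer-mono m (≤-trans (s≤s (m≤n⇒m≤1+n (n≤double n)))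
                              (proj₂ (bounded u) (consPath x∈Fu p avoids)))
               (proj₁ first))
        where
        -- An even rank would label `u`, an odd one would label a follower of `u`.
        unranked : ∀ {j} → ¬ Rank m j u
        unranked (inj₁ (_ , _ , s , _))               = unlabelled (_ , s)
        unranked (inj₂ (_ , _ , (_ , w∈Fu , s) , _)) = independent w∈Fu (_ , s)

        avoids : ∀ i → Path.vertex p i ≢ u
        avoids i eq with j , _ , rank ← ranks i = unranked (subst (Rank m j) eq rank)

    -- The labelling as a γ-function.

    HasValue : V → Pred ℕ∞ (v ⊔ e)
    HasValue u [ m ] = Label m u
    HasValue u ⊤⁺    = ∀ m → ¬ Label m u

    hasValue : ∀ u → ∃ (HasValue u)
    hasValue u with em {P = ∃[ m ] Label m u}
    ... | yes (m , label) = [ m ] , label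
    ... | no  none        = ∞ , λ m label → none (m , label)

    γ : V → ℕ∞
    γ u = proj₁ (hasValue u)

    γ-value : ∀ {u x} → γ u ≡ x → HasValue u x
    γ-value {u} eq = subst (HasValue u) eq (proj₂ (hasValue u))

    Label⇒γ : ∀ {u m} → Label m u → γ u ≡ [ m ]
    Label⇒γ {u} label with hasValue u
    ... | [ k ] , label′ = cong [_] (Label-unique label′ label)
    ... | ⊤⁺    , none   = contradiction label (none _)

    -- This stage is the counter. Binding the label inside the predicate lets stages of different
    -- vertices be compared without transport along equal labels.
    firstStage : ∀ u → γ u <⁺ ∞ → ∃ (IsLeast (λ n → ∃[ m ] Stage m n u))
    firstStage u γu<∞
      with m , eq ← <⁺∞⇒finite γu<∞
      with n , s ← γ-value {u} eq = least (n , m , s)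

    γ-hasCounter : LocallyPathBounded → ∀ j r → HasCounter j r γ
    γ-hasCounter bounded j r = ℕ-infiniteWellOrder j r , counter , record
      { condA = condA
      ; condB = condB
      ; condC = condC
      }
      where
      counter : Vᶠ γ → Lift j ℕ
      counter (u , γu<∞) = lift (proj₁ (firstStage u γu<∞))

      γ⟨F⟩⇒Label : ∀ {u m} → m ∈ γ⟨F_⟩ γ u → ∃[ w ] (w ∈ F u × Label m w)
      γ⟨F⟩⇒Label (w , w∈Fu , eq) = w , w∈Fu , γ-value eq

      Label⇒γ⟨F⟩ : ∀ {u m} → ∃[ w ] (w ∈ F u × Label m w) → m ∈ γ⟨F_⟩ γ u
      Label⇒γ⟨F⟩ (w , w∈Fu , label) = w , w∈Fu , Label⇒γ label

      Label⇒mex : ∀ {u m} → Label m u → γ′_≔_ γ u m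
      Label⇒mex {u} {m} label@(_ , s) =
        (λ m∈ → let w , w∈Fu , _ , t = γ⟨F⟩⇒Label m∈ in Stage-independent m _ _ s w∈Fu t) ,
        (λ n∉ → ≮⇒≥ λ n<m → n∉ (Label⇒γ⟨F⟩ (Full⁻ (Label⇒Full label) n<m)))

      condA : ∀ u → γ u <⁺ ∞ → ∃[ m ] ((γ′_≔_ γ u m) × γ u ≡ [ m ])
      condA u γu<∞ with m , eq ← <⁺∞⇒finite γu<∞ = m , Label⇒mex (γ-value eq) , eq

      condB : ∀ (u : Vᶠ γ) x → x ∈ F (proj₁ u) → γ (proj₁ u) <⁺ γ x →
              Σ[ w ∈ Vᶠ γ ] (proj₁ w ∈ F x × γ (proj₁ w) ≡ γ (proj₁ u)
                × Lift r (lower (counter w) < lower (counter u)))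
      condB (u , γu<∞) x x∈Fu γu<γx
        with firstStage u γu<∞
      ... | suc n , (m , s@(_ , _ , answer)) , _ with answer x∈Fu
      ...   | inj₁ below with l , l<m , label ← Below⁻ m below =
        contradiction
          ([<]-injective (subst₂ _<⁺_ (Label⇒γ (_ , s)) (Label⇒γ label) γu<γx))
          (<-asym l<m)
      -- `t` bounds the first stage of `w` by `n`, while that of `u` is `suc n`.
      ...   | inj₂ (w , w∈Fx , t) =
        (w , γw<∞) , w∈Fx , trans γw≡m (sym (Label⇒γ (_ , s))) ,
        lift (s≤s (proj₂ (proj₂ (firstStage w γw<∞)) (m , t)))
        where
        γw≡m : γ w ≡ [ m ]
        γw≡m = Label⇒γ (_ , t)

        γw<∞ : γ w <⁺ ∞
        γw<∞ = subst (_<⁺ ∞) (sym γw≡m) [ m ]<⊤⁺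

      Unanswered : V → Set (v ⊔ e)
      Unanswered u =
        ∃[ x ] (x ∈ F u × γ x ≡ ∞ × ∃[ m ] ((γ′_≔_ γ u m) × m ∉ γ⟨F_⟩ γ x))

      condC : ∀ u → γ u ≡ ∞ → Unanswered u
      condC u γu≡∞ = unanswered
        where
        unlabelled : ∀ m → ¬ Label m u
        unlabelled = γ-value γu≡∞

        mex : ∃ (IsMex (γ⟨F_⟩ γ u))
        mex = least (proj₁ (bounded u) , fresh)
          where
          -- A follower labelled `b(u)` starts a path of that length through labelled vertices;
          -- prepending the unlabelled `u` makes it too long.
          fresh : proj₁ (bounded u) ∉ γ⟨F_⟩ γ u
          fresh m∈ with w , w∈Fu , label ← γ⟨F⟩⇒Label m∈
                   with p , labels ← rankedPath Label Label-unique
                          (λ l → Full⁻ (Label⇒Full l) ≤-refl) _ label =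
            1+n≰n (proj₂ (bounded u) (consPath w∈Fu p λ i eq →
              let k , _ , label′ = labels i in
              unlabelled k (subst (Label k) eq label′)))

        m : ℕ
        m = proj₁ mex

        unanswered : Unanswered u
        -- If condition C failed at `u`, every follower would be below `m` or answered, and closure
        -- would give `u` the label `m`.
        unanswered = dne λ none → unlabelled m (Label-closed bounded m
          (λ below → let l , _ , label = Below⁻ m below in unlabelled l label)
          (Full⁺ m (γ⟨F⟩⇒Label ∘ below-mex (proj₂ mex)))
          (λ w∈Fu label → proj₁ (proj₂ mex) (Label⇒γ⟨F⟩ (_ , w∈Fu , label)))
          (λ {x} x∈Fu → answer none x∈Fu (γ x) refl))
          where
          answer : ¬ Unanswered u →
                   ∀ {x} → x ∈ F u → ∀ z → γ x ≡ z →
                   Below m x ⊎ (∃[ w ] (w ∈ F x × Label m w))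
          answer none {x} x∈Fu ⊤⁺ eq =
            inj₂ (γ⟨F⟩⇒Label (dne λ m∉ → none (x , x∈Fu , eq , m , proj₂ mex , m∉)))
          answer none {x} x∈Fu [ k ] eq with <-cmp k m
          ... | tri< k<m _ _  = inj₁ (Below⁺ k<m (γ-value eq))
          ... | tri≈ _ refl _ = contradiction (x , x∈Fu , eq) (proj₁ (proj₂ mex))
          ... | tri> _ _ m<k  = inj₂ (Full⁻ (Label⇒Full (γ-value {x} eq)) m<k)

theorem1 : (∀ {ℓ} → ExcludedMiddle ℓ) →
    ∀ {v e j r} (G : Digraph v e) → let open Digraph G in
    LocallyPathBounded →
    ∃! _≗_ (HasCounter j r)
    × (∀ γ → HasCounter j r γ → ∀ u k → γ u ≡ [ k ] →
    ∃[ l ] (IsLongestPathLength u l × k ≤ l))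
theorem1 em {j = j} {r} G bounded =
  (γ em G , hasCounter , γ-unique em G hasCounter) ,
  λ _ h u k eq → let l , longest = longestPath em G bounded u in
    l , longest , proj₂ longest (γ-path em G h eq)
  where
  hasCounter = γ-hasCounter em G bounded j r
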